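{- Let $n\ge 2$ be an integer, and let $x_1,x_2,\ldots,x_n$ and $g$ be real numbers such that $x_1\le x_2\le\ldots\le x_n$ and $g>0$. Let $(a_1,a_2,\ldots,a_{2n})=(x_1,x_1+g,x_2,x_2+g,\ldots,x_n,x_n+g)$, that is, $a_{2i-1}=x_i$ and $a_{2i}=x_i+g$ for $1\le i\le n$, and let $\pi$ be a permutation of $\{1,\ldots,2n\}$ such that $b_1\le b_2\le\ldots\le b_{2n}$, where $b_i=a_{\pi(i)}$ for $1\le i\le 2n$. Put $$R=\sum_{i=1}^n b_{2i},\qquad U=\sum_{i=1}^n b_{2i-1},\qquad G=\min\{x_{i+1}-x_i\mid 1\le i\le n-1\}.$$ Then $R-U\le ng$, with equality if and only if $G\ge g$. -}

module Defs where

open import Algebra.Bundles.Raw using (RawMonoid)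
open import Data.Fin using (Fin; zero; suc; inject₁; combine; remQuot)
open import Data.Nat as ℕ using (ℕ; zero; suc)
import Data.Nat.Properties as ℕ
open import Data.Product using (∃; _×_; _,_)
open import Data.Rational as ℚ using (ℚ; 0ℚ; ½; ∣_∣)
import Data.Rational.Properties as ℚ
open import Data.Rational.Solver using (module +-*-Solver)
open import Data.Sum using (inj₁; inj₂)
open import Data.Vec.Functional using (Vector)
open import Level using (0ℓ)
open import Relation.Binary.PropositionalEquality using (_≡_; refl; sym; trans; cong; subst)

-- ℝ is the setoid of Cauchy sequences of rationals, two of them being equal
-- when their difference tends to 0.  The arithmetic operations are pointwise.

Cauchy : (ℕ → ℚ) → Set
Cauchy s = ∀ ε → 0ℚ ℚ.< ε →
  ∃ λ N → ∀ m n → N ℕ.≤ m → N ℕ.≤ n → ∣ s m ℚ.- s n ∣ ℚ.< ε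

record ℝ : Set where
  constructor mkℝ
  field
    seq    : ℕ → ℚ
    cauchy : Cauchy seq

open ℝ public

infix 4 _≈_ _≤_ _<_

_≈_ : ℝ → ℝ → Set
x ≈ y = ∀ ε → 0ℚ ℚ.< ε →
  ∃ λ N → ∀ n → N ℕ.≤ n → ∣ seq x n ℚ.- seq y n ∣ ℚ.< ε

_<_ : ℝ → ℝ → Set
x < y = ∃ λ ε → 0ℚ ℚ.< ε ×
  (∃ λ N → ∀ n → N ℕ.≤ n → seq x n ℚ.+ ε ℚ.< seq y n)

-- Constructively this is equivalent to ¬ (y < x), not to x < y ⊎ x ≈ y.
_≤_ : ℝ → ℝ → Set
x ≤ y = ∀ ε → 0ℚ ℚ.< ε →
  ∃ λ N → ∀ n → N ℕ.≤ n → seq x n ℚ.< seq y n ℚ.+ ε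

-- Abstract so that normalising real expressions does not unfold these proofs.
abstract
  half>0 : ∀ {ε} → 0ℚ ℚ.< ε → 0ℚ ℚ.< ½ ℚ.* ε
  half>0 {ε} ε>0 =
    subst (ℚ._< ½ ℚ.* ε) (ℚ.*-zeroʳ ½) (ℚ.*-monoʳ-<-pos ½ ε>0)

  half+half : ∀ ε → ½ ℚ.* ε ℚ.+ ½ ℚ.* ε ≡ ε
  half+half ε = trans (sym (ℚ.*-distribʳ-+ ε ½ ½)) (ℚ.*-identityˡ ε)

  p≤∣p∣ : ∀ p → p ℚ.≤ ∣ p ∣
  p≤∣p∣ p with ℚ.≤-total 0ℚ p
  ... | inj₁ 0≤p = ℚ.≤-reflexive (sym (ℚ.0≤p⇒∣p∣≡p 0≤p))
  ... | inj₂ p≤0 = ℚ.≤-trans p≤0 (ℚ.0≤∣p∣ p)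

  ∣p-q∣<ε⇒p<q+ε : ∀ p q {ε} → ∣ p ℚ.- q ∣ ℚ.< ε → p ℚ.< q ℚ.+ ε
  ∣p-q∣<ε⇒p<q+ε p q {ε} h =
    subst (ℚ._< q ℚ.+ ε) (solve 2 (λ p q → q :+ (p :- q) := p) refl p q)
          (ℚ.+-monoʳ-< q (ℚ.≤-<-trans (p≤∣p∣ (p ℚ.- q)) h))
    where open +-*-Solver

  p<q+ε⇒p-q<ε : ∀ p q {ε} → p ℚ.< q ℚ.+ ε → p ℚ.- q ℚ.< ε
  p<q+ε⇒p-q<ε p q {ε} h =
    subst (p ℚ.- q ℚ.<_) (solve 2 (λ q ε → q :+ ε :- q := ε) refl q ε)
          (ℚ.+-monoˡ-< (ℚ.- q) h)
    where open +-*-Solver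

  ∣p-q∣<ε : ∀ p q {ε} → p ℚ.< q ℚ.+ ε → q ℚ.< p ℚ.+ ε → ∣ p ℚ.- q ∣ ℚ.< ε
  ∣p-q∣<ε p q {ε} h k with ℚ.∣p∣≡p∨∣p∣≡-p (p ℚ.- q)
  ... | inj₁ e = subst (ℚ._< ε) (sym e) (p<q+ε⇒p-q<ε p q h)
  ... | inj₂ e = subst (ℚ._< ε)
          (sym (trans e (solve 2 (λ p q → :- (p :- q) := q :- p) refl p q)))
          (p<q+ε⇒p-q<ε q p k)
    where open +-*-Solver

  +-bound : ∀ p q r s ε → ∣ p ℚ.- r ∣ ℚ.< ½ ℚ.* ε → ∣ q ℚ.- s ∣ ℚ.< ½ ℚ.* ε →
            ∣ (p ℚ.+ q) ℚ.- (r ℚ.+ s) ∣ ℚ.< ε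
  +-bound p q r s ε h k = begin-strict
    ∣ (p ℚ.+ q) ℚ.- (r ℚ.+ s) ∣    ≡⟨ cong ∣_∣ (solve 4 (λ p q r s →
                                        (p :+ q) :- (r :+ s) := (p :- r) :+ (q :- s)) refl p q r s) ⟩
    ∣ (p ℚ.- r) ℚ.+ (q ℚ.- s) ∣    ≤⟨ ℚ.∣p+q∣≤∣p∣+∣q∣ (p ℚ.- r) (q ℚ.- s) ⟩
    ∣ p ℚ.- r ∣ ℚ.+ ∣ q ℚ.- s ∣    <⟨ ℚ.+-mono-< h k ⟩
    ½ ℚ.* ε ℚ.+ ½ ℚ.* ε            ≡⟨ half+half ε ⟩
    ε                              ∎
    where
    open +-*-Solver
    open ℚ.≤-Reasoning

  ⊓-bound : ∀ p q r s {ε} → ∣ p ℚ.- r ∣ ℚ.< ε → ∣ q ℚ.- s ∣ ℚ.< ε →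
            p ℚ.⊓ q ℚ.< (r ℚ.⊓ s) ℚ.+ ε
  ⊓-bound p q r s {ε} h k with ℚ.⊓-sel r s
  ... | inj₁ e = subst (λ t → p ℚ.⊓ q ℚ.< t ℚ.+ ε) (sym e)
                   (ℚ.≤-<-trans (ℚ.p⊓q≤p p q) (∣p-q∣<ε⇒p<q+ε p r h))
  ... | inj₂ e = subst (λ t → p ℚ.⊓ q ℚ.< t ℚ.+ ε) (sym e)
                   (ℚ.≤-<-trans (ℚ.p⊓q≤q p q) (∣p-q∣<ε⇒p<q+ε q s k))

  +-cauchy : ∀ {s t} → Cauchy s → Cauchy t → Cauchy (λ n → s n ℚ.+ t n)
  +-cauchy {s} {t} cs ct ε ε>0 =
    let M , p = cs (½ ℚ.* ε) (half>0 ε>0)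
        N , q = ct (½ ℚ.* ε) (half>0 ε>0)
    in M ℕ.⊔ N , λ m n hm hn →
       +-bound (s m) (t m) (s n) (t n) ε
         (p m n (ℕ.m⊔n≤o⇒m≤o M N hm) (ℕ.m⊔n≤o⇒m≤o M N hn))
         (q m n (ℕ.m⊔n≤o⇒n≤o M N hm) (ℕ.m⊔n≤o⇒n≤o M N hn))

  neg-cauchy : ∀ {s} → Cauchy s → Cauchy (λ n → ℚ.- s n)
  neg-cauchy {s} cs ε ε>0 =
    let N , p = cs ε ε>0
    in N , λ m n hm hn →
       subst (λ t → ∣ t ∣ ℚ.< ε)
         (solve 2 (λ a b → b :- a := :- a :- :- b) refl (s m) (s n))
         (p n m hn hm)
    where open +-*-Solver

  ⊓-cauchy : ∀ {s t} → Cauchy s → Cauchy t → Cauchy (λ n → s n ℚ.⊓ t n)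
  ⊓-cauchy {s} {t} cs ct ε ε>0 =
    let M , p = cs ε ε>0
        N , q = ct ε ε>0
        s-close = λ m n hm hn → p m n (ℕ.m⊔n≤o⇒m≤o M N hm) (ℕ.m⊔n≤o⇒m≤o M N hn)
        t-close = λ m n hm hn → q m n (ℕ.m⊔n≤o⇒n≤o M N hm) (ℕ.m⊔n≤o⇒n≤o M N hn)
    in M ℕ.⊔ N , λ m n hm hn →
       ∣p-q∣<ε (s m ℚ.⊓ t m) (s n ℚ.⊓ t n)
         (⊓-bound (s m) (t m) (s n) (t n) (s-close m n hm hn) (t-close m n hm hn))
         (⊓-bound (s n) (t n) (s m) (t m) (s-close n m hn hm) (t-close n m hn hm))

infix  8 -_
infixl 7 _⊓_
infixl 6 _+_ _-_

0ℝ : ℝ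
0ℝ = mkℝ (λ _ → 0ℚ) (λ ε ε>0 → 0 , λ _ _ _ _ → ε>0)

_+_ : ℝ → ℝ → ℝ
x + y = mkℝ (λ n → seq x n ℚ.+ seq y n) (+-cauchy {seq x} {seq y} (cauchy x) (cauchy y))

-_ : ℝ → ℝ
- x = mkℝ (λ n → ℚ.- seq x n) (neg-cauchy {seq x} (cauchy x))

_-_ : ℝ → ℝ → ℝ
x - y = x + (- y)

_⊓_ : ℝ → ℝ → ℝ
x ⊓ y = mkℝ (λ n → seq x n ℚ.⊓ seq y n) (⊓-cauchy {seq x} {seq y} (cauchy x) (cauchy y))

+-0-rawMonoid : RawMonoid 0ℓ 0ℓ
+-0-rawMonoid = record { Carrier = ℝ ; _≈_ = _≈_ ; _∙_ = _+_ ; ε = 0ℝ }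

open import Algebra.Definitions.RawMonoid +-0-rawMonoid public
  using (sum) renaming (_×_ to _·_)

minimum : ∀ {n} → Vector ℝ (suc n) → ℝ
minimum {zero}  v = v zero
minimum {suc n} v = v zero ⊓ minimum (λ i → v (suc i))

minGap : ∀ {n} → 2 ℕ.≤ n → Vector ℝ n → ℝ
minGap {suc (suc _)} _ x = minimum (λ i → x (suc i) - x (inject₁ i))
minGap {suc zero}    (ℕ.s≤s ()) _

-- The 1-based position k is the element of Fin (n * 2) of value k - 1, so for
-- the 1-based index i, odd i is position 2i - 1 and even i is position 2i.

odd even : ∀ {n} → Fin n → Fin (n ℕ.* 2)
odd  i = combine i zero
even i = combine i (suc zero)

-- The vector (x₁ , x₁ + g , x₂ , x₂ + g , … , xₙ , xₙ + g).
pairs : ∀ {n} → Vector ℝ n → ℝ → Vector ℝ (n ℕ.* 2)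
pairs x g k with remQuot 2 k
... | i , zero     = x i
... | i , suc zero = x i + g

{-# OPTIONS --safe #-}

-- Pairing consecutive entries of a sorted sequence minimises the sum of the
-- distances within the pairs, over all ways to split the entries into pairs.
-- Splitting a into the pairs (x_i , x_i + g) shows R - U ≤ ng.  Replacing the
-- pairs i and i + 1 by (x_i , x_{i+1}) and (x_i + g , x_{i+1} + g) improves
-- this to R - U ≤ ng - 2g + 2(x_{i+1} - x_i), so equality forces g ≤ G.
-- Conversely, if g ≤ G then a is itself sorted, and minimality for a, compared
-- with the pairs (b_{2i-1} , b_{2i}), gives ng ≤ R - U.
--
-- For the minimality, sort the indices by inserting them two at a time:
-- inserting u and v into a sorted list changes its alternating sum by at most
-- the distance of the two values.  Since indices rather than reals are compared,
-- no decision about the order of reals is needed.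

module Submission where

open import Defs
open import Data.Nat as ℕ using (ℕ; zero; suc)
import Data.Nat.Properties as ℕ
open import Data.Fin as Fin using (Fin; zero; suc; inject₁; combine)
import Data.Fin.Properties as Fin
open import Data.Fin.Permutation using (Permutation′; _⟨$⟩ʳ_; _⟨$⟩ˡ_; _∘ₚ_; flip; transpose; inverseˡ; inverseʳ)
open import Data.List using (List; []; _∷_; tabulate; allFin)
open import Data.List.Membership.Propositional using (_∈_)
open import Data.List.Membership.Propositional.Properties using (∈-tabulate⁺; ∈-allFin)
open import Data.List.Membership.Propositional.Properties.WithK using (unique∧set⇒bag)
open import Data.List.Relation.Binary.BagAndSetEquality using (∼bag⇒↭)
open import Data.List.Relation.Binary.Permutation.Propositional using (↭-trans; ↭⇒↭ₛ)
open import Data.List.Relation.Binary.Pointwise using (Pointwise-≡⇒≡)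
open import Data.List.Relation.Unary.AllPairs.Properties using (tabulate⁺-<)
open import Data.List.Relation.Unary.Linked using ([]; [-]; _∷_)
open import Data.List.Relation.Unary.Sorted.TotalOrder.Properties using (↗↭↗⇒≋; AllPairs⇒Sorted)
open import Data.List.Relation.Unary.Unique.Propositional.Properties using (tabulate⁺; allFin⁺)
open import Data.Product using (_×_; _,_; proj₁)
open import Data.Rational as ℚ using (0ℚ; ½)
import Data.Rational.Properties as ℚ
open import Data.Rational.Solver using (module +-*-Solver)
open import Data.Sum using (inj₁; inj₂)
open import Data.Vec.Functional using (Vector)
open import Function using (_∘_; id)
open import Function.Bundles using (_⇔_; mk⇔)
open import Relation.Binary.Core using (_Preserves_⟶_)
open import Relation.Binary.Definitions using (tri<; tri≈; tri>)
open import Relation.Binary.PropositionalEquality using (_≡_; _≢_; _≗_; refl; sym; trans; cong; cong₂; subst; subst₂; module ≡-Reasoning)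
open import Relation.Nullary using (¬_; yes; no; contradiction)
open import Relation.Nullary.Decidable using (dec-true; dec-false)

open +-*-Solver using (solve; _:=_; _:+_; _:-_; :-_; con)

-- The order on ℝ

pointwise-≤ : ∀ {x y} → (∀ m → seq x m ℚ.≤ seq y m) → x ≤ y
pointwise-≤ {x} {y} h ε ε>0 = 0 , λ m _ →
  ℚ.≤-<-trans (h m)
    (subst (ℚ._< seq y m ℚ.+ ε) (ℚ.+-identityʳ (seq y m)) (ℚ.+-monoʳ-< (seq y m) ε>0))

≤-refl : ∀ {x} → x ≤ x
≤-refl {x} = pointwise-≤ {x} {x} (λ _ → ℚ.≤-refl)

≤-trans : ∀ {x y z} → x ≤ y → y ≤ z → x ≤ z
≤-trans {x} {y} {z} x≤y y≤z ε ε>0 =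
  let M , p = x≤y (½ ℚ.* ε) (half>0 ε>0)
      N , q = y≤z (½ ℚ.* ε) (half>0 ε>0)
  in M ℕ.⊔ N , λ m M⊔N≤m → begin-strict
    seq x m                                <⟨ p m (ℕ.m⊔n≤o⇒m≤o M N M⊔N≤m) ⟩
    seq y m ℚ.+ ½ ℚ.* ε                    <⟨ ℚ.+-monoˡ-< (½ ℚ.* ε) (q m (ℕ.m⊔n≤o⇒n≤o M N M⊔N≤m)) ⟩
    seq z m ℚ.+ ½ ℚ.* ε ℚ.+ ½ ℚ.* ε        ≡⟨ ℚ.+-assoc (seq z m) (½ ℚ.* ε) (½ ℚ.* ε) ⟩
    seq z m ℚ.+ (½ ℚ.* ε ℚ.+ ½ ℚ.* ε)      ≡⟨ cong (seq z m ℚ.+_) (half+half ε) ⟩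
    seq z m ℚ.+ ε                          ∎
  where open ℚ.≤-Reasoning

≤-antisym : ∀ {x y} → x ≤ y → y ≤ x → x ≈ y
≤-antisym {x} {y} x≤y y≤x ε ε>0 =
  let M , p = x≤y ε ε>0
      N , q = y≤x ε ε>0
  in M ℕ.⊔ N , λ m M⊔N≤m →
    ∣p-q∣<ε (seq x m) (seq y m) (p m (ℕ.m⊔n≤o⇒m≤o M N M⊔N≤m)) (q m (ℕ.m⊔n≤o⇒n≤o M N M⊔N≤m))

≈⇒≥ : ∀ {x y} → x ≈ y → y ≤ x
≈⇒≥ {x} {y} x≈y ε ε>0 =
  let N , p = x≈y ε ε>0
  in N , λ m N≤m → ∣p-q∣<ε⇒p<q+ε (seq y m) (seq x m)
       (subst (ℚ._< ε) (trans (sym (ℚ.∣-p∣≡∣p∣ (seq x m ℚ.- seq y m)))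
          (cong ℚ.∣_∣ (solve 2 (λ x y → :- (x :- y) := y :- x) refl (seq x m) (seq y m))))
          (p m N≤m))

<⇒≤ : ∀ {x y} → x < y → x ≤ y
<⇒≤ {x} {y} (δ , δ>0 , N , x+δ<y) ε ε>0 = N , λ m N≤m → begin-strict
  seq x m           ≡⟨ ℚ.+-identityʳ (seq x m) ⟨
  seq x m ℚ.+ 0ℚ    <⟨ ℚ.+-monoʳ-< (seq x m) δ>0 ⟩
  seq x m ℚ.+ δ     <⟨ x+δ<y m N≤m ⟩
  seq y m           ≡⟨ ℚ.+-identityʳ (seq y m) ⟨
  seq y m ℚ.+ 0ℚ    <⟨ ℚ.+-monoʳ-< (seq y m) ε>0 ⟩
  seq y m ℚ.+ ε     ∎
  where open ℚ.≤-Reasoning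

+-mono-≤ : ∀ {x y u v} → x ≤ y → u ≤ v → x + u ≤ y + v
+-mono-≤ {x} {y} {u} {v} x≤y u≤v ε ε>0 =
  let M , p = x≤y (½ ℚ.* ε) (half>0 ε>0)
      N , q = u≤v (½ ℚ.* ε) (half>0 ε>0)
  in M ℕ.⊔ N , λ m M⊔N≤m → begin-strict
    seq x m ℚ.+ seq u m
      <⟨ ℚ.+-mono-< (p m (ℕ.m⊔n≤o⇒m≤o M N M⊔N≤m)) (q m (ℕ.m⊔n≤o⇒n≤o M N M⊔N≤m)) ⟩
    (seq y m ℚ.+ ½ ℚ.* ε) ℚ.+ (seq v m ℚ.+ ½ ℚ.* ε)
      ≡⟨ solve 3 (λ y v h → (y :+ h) :+ (v :+ h) := (y :+ v) :+ (h :+ h)) refl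
           (seq y m) (seq v m) (½ ℚ.* ε) ⟩
    seq y m ℚ.+ seq v m ℚ.+ (½ ℚ.* ε ℚ.+ ½ ℚ.* ε)
      ≡⟨ cong (seq y m ℚ.+ seq v m ℚ.+_) (half+half ε) ⟩
    seq y m ℚ.+ seq v m ℚ.+ ε
      ∎
  where open ℚ.≤-Reasoning

-- The hypothesis says y - x = q - p; written without subtraction.
≤-shift : ∀ {p q} x y → p ≤ q →
          (∀ m → seq x m ℚ.+ seq q m ≡ seq p m ℚ.+ seq y m) → x ≤ y
≤-shift {p} {q} x y p≤q eq ε ε>0 =
  let N , h = p≤q ε ε>0
  in N , λ m N≤m → begin-strict
    seq x m
      ≡⟨ solve 2 (λ x p → x := p :+ (x :- p)) refl (seq x m) (seq p m) ⟩
    seq p m ℚ.+ (seq x m ℚ.- seq p m)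
      <⟨ ℚ.+-monoˡ-< (seq x m ℚ.- seq p m) (h m N≤m) ⟩
    (seq q m ℚ.+ ε) ℚ.+ (seq x m ℚ.- seq p m)
      ≡⟨ solve 4 (λ q ε x p → (q :+ ε) :+ (x :- p) := (x :+ q) :+ (ε :- p)) refl
           (seq q m) ε (seq x m) (seq p m) ⟩
    (seq x m ℚ.+ seq q m) ℚ.+ (ε ℚ.- seq p m)
      ≡⟨ cong (ℚ._+ (ε ℚ.- seq p m)) (eq m) ⟩
    (seq p m ℚ.+ seq y m) ℚ.+ (ε ℚ.- seq p m)
      ≡⟨ solve 3 (λ p y ε → (p :+ y) :+ (ε :- p) := y :+ ε) refl (seq p m) (seq y m) ε ⟩
    seq y m ℚ.+ ε
      ∎
  where open ℚ.≤-Reasoning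

double-cancel-≤ : ∀ x y → x + x ≤ y + y → x ≤ y
double-cancel-≤ x y 2x≤2y ε ε>0 =
  -- The doubled values are compared with tolerance `ε + ε`. A term with `y + ε ≤ x` would double to
  -- a contradiction, and the order on ℚ is decidable.
  let N , h = 2x≤2y (ε ℚ.+ ε) (ℚ.+-mono-< ε>0 ε>0)
  in N , λ m N≤m → ℚ.≰⇒> λ y+ε≤x → ℚ.<-irrefl refl (begin-strict
    seq x m ℚ.+ seq x m                      <⟨ h m N≤m ⟩
    (seq y m ℚ.+ seq y m) ℚ.+ (ε ℚ.+ ε)      ≡⟨ solve 2 (λ y ε → (y :+ y) :+ (ε :+ ε) :=
                                                  (y :+ ε) :+ (y :+ ε)) refl (seq y m) ε ⟩
    (seq y m ℚ.+ ε) ℚ.+ (seq y m ℚ.+ ε)      ≤⟨ ℚ.+-mono-≤ y+ε≤x y+ε≤x ⟩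
    seq x m ℚ.+ seq x m                      ∎)
  where open ℚ.≤-Reasoning

⊓-glb : ∀ {x} y z → x ≤ y → x ≤ z → x ≤ y ⊓ z
⊓-glb {x} y z x≤y x≤z ε ε>0 =
  let M , p = x≤y ε ε>0
      N , q = x≤z ε ε>0
  in M ℕ.⊔ N , λ m M⊔N≤m → bound m
       (p m (ℕ.m⊔n≤o⇒m≤o M N M⊔N≤m)) (q m (ℕ.m⊔n≤o⇒n≤o M N M⊔N≤m))
  where
  bound : ∀ m → seq x m ℚ.< seq y m ℚ.+ ε → seq x m ℚ.< seq z m ℚ.+ ε →
          seq x m ℚ.< seq (y ⊓ z) m ℚ.+ ε
  bound m h k with ℚ.⊓-sel (seq y m) (seq z m)
  ... | inj₁ e = subst (λ t → seq x m ℚ.< t ℚ.+ ε) (sym e) h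
  ... | inj₂ e = subst (λ t → seq x m ℚ.< t ℚ.+ ε) (sym e) k

minimum-glb : ∀ {n x} (v : Vector ℝ (suc n)) → (∀ i → x ≤ v i) → x ≤ minimum v
minimum-glb {zero}  v h = h zero
minimum-glb {suc n} {x} v h =
  ⊓-glb {x} (v zero) (minimum (v ∘ suc)) (h zero) (minimum-glb {n} {x} (v ∘ suc) (h ∘ suc))

minimum-≤ : ∀ {n} (v : Vector ℝ (suc n)) i → minimum v ≤ v i
minimum-≤ {zero}  v zero    = ≤-refl {v zero}
minimum-≤ {suc n} v zero    = pointwise-≤ {minimum v} {v zero} λ m →
  ℚ.p⊓q≤p (seq (v zero) m) _
minimum-≤ {suc n} v (suc i) = ≤-trans {minimum v} {minimum (v ∘ suc)} {v (suc i)}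
  (pointwise-≤ {minimum v} {minimum (v ∘ suc)} λ m →
    ℚ.p⊓q≤q (seq (v zero) m) (seq (minimum (v ∘ suc)) m))
  (minimum-≤ (v ∘ suc) i)

-- Finite sums

sum-cong-≗ : ∀ {n} {v w : Vector ℝ n} → v ≗ w → sum v ≡ sum w
sum-cong-≗ {zero}  v≗w = refl
sum-cong-≗ {suc n} v≗w = cong₂ _+_ (v≗w zero) (sum-cong-≗ (v≗w ∘ suc))

sum-+-const : ∀ {n} (x : Vector ℝ n) g m →
  seq (sum (λ i → x i + g)) m ≡ seq (sum x) m ℚ.+ seq (n · g) m
sum-+-const {zero}  x g m = refl
sum-+-const {suc n} x g m = trans
  (cong (seq (x zero) m ℚ.+ seq g m ℚ.+_) (sum-+-const (x ∘ suc) g m))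
  (solve 4 (λ x g s t → (x :+ g) :+ (s :+ t) := (x :+ s) :+ (g :+ t)) refl
    (seq (x zero) m) (seq g m) (seq (sum (x ∘ suc)) m) (seq (n · g) m))

-- Both sides equal the common terms plus `v j + w j`. Stated termwise and without subtraction, the
-- equation can be used directly in ring identities over ℚ.
sum-change-at : ∀ {n} (v w : Vector ℝ n) j → (∀ i → i ≢ j → v i ≡ w i) → ∀ m →
  seq (sum v) m ℚ.+ seq (w j) m ≡ seq (sum w) m ℚ.+ seq (v j) m
sum-change-at {suc n} v w zero eq m = begin
  (v₀ ℚ.+ seq (sum (v ∘ suc)) m) ℚ.+ w₀
    ≡⟨ cong (λ y → (v₀ ℚ.+ seq y m) ℚ.+ w₀) (sum-cong-≗ λ i → eq (suc i) λ ()) ⟩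
  (v₀ ℚ.+ seq (sum (w ∘ suc)) m) ℚ.+ w₀
    ≡⟨ solve 3 (λ v s w → (v :+ s) :+ w := (w :+ s) :+ v) refl v₀ (seq (sum (w ∘ suc)) m) w₀ ⟩
  (w₀ ℚ.+ seq (sum (w ∘ suc)) m) ℚ.+ v₀
    ∎
  where
  open ≡-Reasoning
  v₀ = seq (v zero) m
  w₀ = seq (w zero) m
sum-change-at {suc n} v w (suc j) eq m = begin
  (v₀ ℚ.+ seq (sum (v ∘ suc)) m) ℚ.+ seq (w (suc j)) m
    ≡⟨ ℚ.+-assoc v₀ _ _ ⟩
  v₀ ℚ.+ (seq (sum (v ∘ suc)) m ℚ.+ seq (w (suc j)) m)
    ≡⟨ cong₂ ℚ._+_ (cong (λ y → seq y m) (eq zero λ ()))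
         (sum-change-at (v ∘ suc) (w ∘ suc) j (λ i i≢j → eq (suc i) (i≢j ∘ Fin.suc-injective)) m) ⟩
  w₀ ℚ.+ (seq (sum (w ∘ suc)) m ℚ.+ seq (v (suc j)) m)
    ≡⟨ ℚ.+-assoc w₀ _ _ ⟨
  (w₀ ℚ.+ seq (sum (w ∘ suc)) m) ℚ.+ seq (v (suc j)) m
    ∎
  where
  open ≡-Reasoning
  v₀ = seq (v zero) m
  w₀ = seq (w zero) m

-- Alternating sums over sorted lists of indices

module _ {N : ℕ} where
  open import Data.List.Sort.InsertionSort.Base (Fin.≤-decTotalOrder N) public using (insert; sort)
  open import Data.List.Sort.InsertionSort.Properties (Fin.≤-decTotalOrder N) public using (insert-swap; sort-↗; sort-↭)
  open import Data.List.Relation.Unary.Sorted.TotalOrder (Fin.≤-totalOrder N) public using (Sorted)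

sorted-tail : ∀ {N} {k : Fin N} {l} → Sorted (k ∷ l) → Sorted l
sorted-tail [-]     = []
sorted-tail (_ ∷ h) = h

insert-≤ : ∀ {N} {u y : Fin N} {l} → u Fin.≤ y → insert u (y ∷ l) ≡ u ∷ y ∷ l
insert-≤ {u = u} {y} u≤y rewrite dec-true (u Fin.≤? y) u≤y = refl

insert-≰ : ∀ {N} {u y : Fin N} {l} → ¬ u Fin.≤ y → insert u (y ∷ l) ≡ y ∷ insert u l
insert-≰ {u = u} {y} u≰y rewrite dec-false (u Fin.≤? y) u≰y = refl

-- The head of `insert v l` is `v` or the head of `l`, and `u` is below both.
insert-least : ∀ {N} {u v : Fin N} {l} → u Fin.≤ v → Sorted (u ∷ l) →
  insert u (insert v l) ≡ u ∷ insert v l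
insert-least {l = []} u≤v _ = insert-≤ u≤v
insert-least {v = v} {y ∷ l} u≤v (u≤y ∷ _) with v Fin.≤? y
... | yes v≤y rewrite insert-≤ {l = l} v≤y = insert-≤ u≤v
... | no  v≰y rewrite insert-≰ {l = l} v≰y = insert-≤ u≤y

-- The list of values of `ρ` is duplicate-free and contains every index, so it is a rearrangement of
-- `allFin N`. Two sorted rearrangements of each other are equal.
sort-tabulate-permutation : ∀ {N} (ρ : Permutation′ N) → sort (tabulate (ρ ⟨$⟩ʳ_)) ≡ allFin N
sort-tabulate-permutation {N} ρ = Pointwise-≡⇒≡
  (↗↭↗⇒≋ (Fin.≤-totalOrder N) (sort-↗ (tabulate (ρ ⟨$⟩ʳ_)))
    (AllPairs⇒Sorted (Fin.≤-totalOrder N) (tabulate⁺-< ℕ.<⇒≤))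
    (↭⇒↭ₛ (↭-trans (sort-↭ (tabulate (ρ ⟨$⟩ʳ_)))
      (∼bag⇒↭ (unique∧set⇒bag
        (tabulate⁺ λ eq → trans (sym (inverseˡ ρ)) (trans (cong (ρ ⟨$⟩ˡ_) eq) (inverseˡ ρ)))
        (allFin⁺ N)
        (λ {k} → mk⇔ (λ _ → ∈-allFin k)
             (λ _ → subst (_∈ tabulate (ρ ⟨$⟩ʳ_)) (inverseʳ ρ) (∈-tabulate⁺ (ρ ⟨$⟩ˡ k)))))))))

-- This is `R - U` when `t` is the sorted vector, and the total distance within the pairs whenever
-- `t (odd i) ≤ t (even i)` for all `i`.
spread : ∀ n → Vector ℝ (n ℕ.* 2) → ℝ
spread n t = sum (λ (i : Fin n) → t (even i)) - sum (λ (i : Fin n) → t (odd i))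

module _ {N : ℕ} (s : Vector ℝ N) where

  -- The signs start with minus, so that a list of even length gives second minus first, plus fourth
  -- minus third, and so on. A new first entry negates the sum of the rest.
  alternating : List (Fin N) → ℝ
  alternating []      = 0ℝ
  alternating (k ∷ l) = - (s k + alternating l)

  alternating-tabulate : ∀ n (f : Fin (n ℕ.* 2) → Fin N) m →
    seq (alternating (tabulate f)) m ≡ seq (spread n (s ∘ f)) m
  alternating-tabulate zero    f m = refl
  alternating-tabulate (suc n) f m = begin
    ℚ.- (a ℚ.+ ℚ.- (b ℚ.+ seq (alternating (tabulate f′)) m))
      ≡⟨ cong (λ z → ℚ.- (a ℚ.+ ℚ.- (b ℚ.+ z))) (alternating-tabulate n f′ m) ⟩
    ℚ.- (a ℚ.+ ℚ.- (b ℚ.+ (e ℚ.- o)))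
      ≡⟨ solve 4 (λ a b e o → :- (a :+ :- (b :+ (e :- o))) := (b :+ e) :- (a :+ o)) refl a b e o ⟩
    (b ℚ.+ e) ℚ.- (a ℚ.+ o)
      ∎
    where
    open ≡-Reasoning
    f′ : Fin (n ℕ.* 2) → Fin N
    f′ k = f (suc (suc k))
    a = seq (s (f zero)) m
    b = seq (s (f (suc zero))) m
    e = seq (sum (λ (i : Fin n) → s (f′ (even i)))) m
    o = seq (sum (λ (i : Fin n) → s (f′ (odd i)))) m

  module _ (mono : s Preserves Fin._≤_ ⟶ _≤_) where

    private
      -- Covers the cases where `v` lands in front. The upper bound is `2 s k ≤ 2 s v`, rearranged.
      bounds-from-equality : ∀ {k v} D → k Fin.≤ v → (∀ m → seq D m ≡ ℚ.- seq (s v) m) →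
        (- s v ≤ D) × (D ≤ s v - (s k + s k))
      bounds-from-equality {k} {v} D k≤v eq =
        pointwise-≤ { - s v} {D} (λ m → ℚ.≤-reflexive (sym (eq m))) ,
        ≤-shift {s k + s k} {s v + s v} D (s v - (s k + s k))
          (+-mono-≤ {s k} {s v} {s k} {s v} (mono k≤v) (mono k≤v))
          (λ m → trans (cong (ℚ._+ (seq (s v) m ℚ.+ seq (s v) m)) (eq m))
             (solve 2 (λ v k → :- v :+ (v :+ v) := (k :+ k) :+ (v :- (k :+ k))) refl
               (seq (s v) m) (seq (s k) m)))

    -- Inserting `v` shifts the later entries by one place and so flips their signs; hence the two
    -- alternating sums are added, not subtracted. If `v` lands in front, `D = - s v`. If `v` passes
    -- `y`, then `D = - 2 s y - D′`, which exchanges the two bounds; the lower bound `k` of the list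
    -- is carried along for this.
    insert-bounds : ∀ {k v} l → k Fin.≤ v → Sorted (k ∷ l) →
      let D = alternating (insert v l) + alternating l
      in (- s v ≤ D) × (D ≤ s v - (s k + s k))
    insert-bounds {k} {v} [] k≤v _ =
      bounds-from-equality (alternating (v ∷ []) + 0ℝ) k≤v λ m →
        solve 1 (λ v → :- (v :+ con 0ℚ) :+ con 0ℚ := :- v) refl (seq (s v) m)
    insert-bounds {k} {v} (y ∷ l) k≤v (k≤y ∷ h) with v Fin.≤? y
    ... | yes v≤y rewrite insert-≤ {l = l} v≤y =
      bounds-from-equality (alternating (v ∷ y ∷ l) + alternating (y ∷ l)) k≤v λ m →
        solve 2 (λ v t → :- (v :+ t) :+ t := :- v) refl
          (seq (s v) m) (seq (alternating (y ∷ l)) m)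
    ... | no  v≰y rewrite insert-≰ {l = l} v≰y =
      let D′ = alternating (insert v l) + alternating l
          D  = alternating (y ∷ insert v l) + alternating (y ∷ l)
          lower , upper = insert-bounds {y} {v} l (ℕ.≰⇒≥ v≰y) h
      in
      ≤-shift {D′} {s v - (s y + s y)} (- s v) D upper
        (λ m → solve 4 (λ v y p q →
             :- v :+ (v :- (y :+ y)) := (p :+ q) :+ (:- (y :+ p) :+ :- (y :+ q))) refl
           (seq (s v) m) (seq (s y) m)
           (seq (alternating (insert v l)) m) (seq (alternating l) m)) ,
      ≤-shift { - s v + (s k + s k)} {D′ + (s y + s y)} D (s v - (s k + s k))
        (+-mono-≤ { - s v} {D′} {s k + s k} {s y + s y} lower
          (+-mono-≤ {s k} {s y} {s k} {s y} (mono k≤y) (mono k≤y)))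
        (λ m → solve 5 (λ v y k p q →
             (:- (y :+ p) :+ :- (y :+ q)) :+ ((p :+ q) :+ (y :+ y)) :=
             (:- v :+ (k :+ k)) :+ (v :- (k :+ k))) refl
           (seq (s v) m) (seq (s y) m) (seq (s k) m)
           (seq (alternating (insert v l)) m) (seq (alternating l) m))

    -- Both directions are needed for the induction: a first entry `y` smaller than `u` and `v`
    -- stays in front and negates both sums, turning each inequality into the other.
    insert²-bounds : ∀ {u v} l → u Fin.≤ v → Sorted l →
      let E = alternating (insert u (insert v l))
      in (E ≤ alternating l + (s v - s u)) × (alternating l ≤ E + (s v - s u))

    private
      -- Here `u` lands in front, so `E - A = - s u - (B + A)`, and `insert-bounds` with `k = u`
      -- bounds `B + A`.
      insert²-bounds-least : ∀ {u v} l → u Fin.≤ v → Sorted (u ∷ l) →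
        let E = alternating (insert u (insert v l))
        in (E ≤ alternating l + (s v - s u)) × (alternating l ≤ E + (s v - s u))
      insert²-bounds-least {u} {v} l u≤v h rewrite insert-least u≤v h =
        let A = alternating l
            B = alternating (insert v l)
            E = - (s u + B)
            lower , upper = insert-bounds l u≤v h
        in
        ≤-shift { - s v} {B + A} E (A + (s v - s u)) lower
          (λ m → solve 4 (λ u v a b → :- (u :+ b) :+ (b :+ a) := :- v :+ (a :+ (v :- u))) refl
            (seq (s u) m) (seq (s v) m) (seq A m) (seq B m)) ,
        ≤-shift {B + A} {s v - (s u + s u)} A (E + (s v - s u)) upper
          (λ m → solve 4 (λ u v a b →
               a :+ (v :- (u :+ u)) := (b :+ a) :+ (:- (u :+ b) :+ (v :- u))) refl
            (seq (s u) m) (seq (s v) m) (seq A m) (seq B m))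

    insert²-bounds []      u≤v h = insert²-bounds-least [] u≤v [-]
    insert²-bounds {u} {v} (y ∷ l) u≤v h with u Fin.≤? y
    ... | yes u≤y = insert²-bounds-least (y ∷ l) u≤v (u≤y ∷ h)
    ... | no  u≰y
      rewrite insert-≰ {l = l} (λ v≤y → u≰y (ℕ.≤-trans u≤v v≤y))
            | insert-≰ {l = insert v l} u≰y =
      let A = alternating l
          E = alternating (insert u (insert v l))
          upper , lower = insert²-bounds l u≤v (sorted-tail h)
      in
      ≤-shift {A} {E + (s v - s u)} (- (s y + E)) (- (s y + A) + (s v - s u)) lower
        (λ m → solve 4 (λ y a e d → :- (y :+ e) :+ (e :+ d) := a :+ (:- (y :+ a) :+ d)) refl
          (seq (s y) m) (seq A m) (seq E m) (seq (s v - s u) m)) ,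
      ≤-shift {E} {A + (s v - s u)} (- (s y + A)) (- (s y + E) + (s v - s u)) upper
        (λ m → solve 4 (λ y a e d → :- (y :+ a) :+ (a :+ d) := e :+ (:- (y :+ e) :+ d)) refl
          (seq (s y) m) (seq A m) (seq E m) (seq (s v - s u) m))

    -- The values are known to satisfy `s u ≤ s v`, while the indices may come in either order; the
    -- case distinction is on the indices only.
    alternating-insert² : ∀ u v l → s u ≤ s v → Sorted l →
      alternating (insert u (insert v l)) ≤ alternating l + (s v - s u)
    alternating-insert² u v l su≤sv h with Fin.≤-total u v
    ... | inj₁ u≤v = proj₁ (insert²-bounds l u≤v h)
    ... | inj₂ v≤u rewrite Pointwise-≡⇒≡ (insert-swap u v l) =
      let A = alternating l
          E = alternating (insert v (insert u l))
      in
      -- With the roles exchanged the bound is `A + (s u - s v)`; adding `2 s u ≤ 2 s v` gives the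
      -- bound wanted.
      ≤-shift {E + (s u + s u)} {(A + (s u - s v)) + (s v + s v)} E (A + (s v - s u))
        (+-mono-≤ {E} {A + (s u - s v)} {s u + s u} {s v + s v}
          (proj₁ (insert²-bounds l v≤u h)) (+-mono-≤ {s u} {s v} {s u} {s v} su≤sv su≤sv))
        (λ m → solve 4 (λ u v a e →
             e :+ ((a :+ (u :- v)) :+ (v :+ v)) := (e :+ (u :+ u)) :+ (a :+ (v :- u))) refl
          (seq (s u) m) (seq (s v) m) (seq A m) (seq E m))

    -- Insertion sort adds the indices pair by pair, and each pair raises the alternating sum by at
    -- most its distance.
    alternating-sort : ∀ n (f : Fin (n ℕ.* 2) → Fin N) →
      (∀ (i : Fin n) → s (f (odd i)) ≤ s (f (even i))) →
      alternating (sort (tabulate f)) ≤ spread n (s ∘ f)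
    alternating-sort zero    f h = ≤-refl {0ℝ}
    alternating-sort (suc n) f h =
      let u = f zero
          v = f (suc zero)
          f′ : Fin (n ℕ.* 2) → Fin N
          f′ = λ k → f (suc (suc k))
          l = sort (tabulate f′)
          E = alternating (insert u (insert v l))
          A = alternating l
      in
      ≤-shift {E + A} {(A + (s v - s u)) + spread n (s ∘ f′)} E (spread (suc n) (s ∘ f))
        (+-mono-≤ {E} {A + (s v - s u)} {A} {spread n (s ∘ f′)}
          (alternating-insert² u v l (h zero) (sort-↗ (tabulate f′)))
          (alternating-sort n f′ (h ∘ suc)))
        (λ m → solve 6 (λ E A v u e o →
             E :+ ((A :+ (v :- u)) :+ (e :- o)) := (E :+ A) :+ ((v :+ e) :- (u :+ o))) refl
          (seq E m) (seq A m) (seq (s v) m) (seq (s u) m)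
          (seq (sum (λ (i : Fin n) → s (f′ (even i)))) m) (seq (sum (λ (i : Fin n) → s (f′ (odd i)))) m))

-- Minimality of the spread of a sorted vector

spread-cong : ∀ n {t t′ : Vector ℝ (n ℕ.* 2)} → t ≗ t′ → spread n t ≡ spread n t′
spread-cong n t≗t′ = cong₂ _-_ (sum-cong-≗ (λ (i : Fin n) → t≗t′ (even i))) (sum-cong-≗ (λ (i : Fin n) → t≗t′ (odd i)))

-- Sorting the indices `ρ k` yields all indices in order, whose alternating sum is `spread n s`; in
-- the order given by `ρ` they form the pairs of `t`.
sorted-minimises-spread : ∀ n (s t : Vector ℝ (n ℕ.* 2)) (ρ : Permutation′ (n ℕ.* 2)) →
  s Preserves Fin._≤_ ⟶ _≤_ →
  (∀ k → s (ρ ⟨$⟩ʳ k) ≡ t k) →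
  (∀ (i : Fin n) → t (odd i) ≤ t (even i)) →
  spread n s ≤ spread n t
sorted-minimises-spread n s t ρ mono sρ≗t h =
  ≤-trans {spread n s} {alternating s (allFin (n ℕ.* 2))} {spread n t}
    (pointwise-≤ {spread n s} {alternating s (allFin (n ℕ.* 2))} λ m →
      ℚ.≤-reflexive (sym (alternating-tabulate s n id m)))
    (subst₂ _≤_ (cong (alternating s) (sort-tabulate-permutation ρ)) (spread-cong n sρ≗t)
      (alternating-sort s mono n (ρ ⟨$⟩ʳ_) λ i →
        subst₂ _≤_ (sym (sρ≗t (odd i))) (sym (sρ≗t (even i))) (h i)))

-- The vector (x₁ , x₁ + g , … , xₙ , xₙ + g)

x≤x+g : ∀ {g} x → 0ℝ < g → x ≤ x + g
x≤x+g {g} x g>0 = ≤-shift {0ℝ} {g} x (x + g) (<⇒≤ {0ℝ} {g} g>0) λ m → sym (ℚ.+-identityˡ _)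

odd<even : ∀ {n} (i : Fin n) → odd i Fin.< even i
odd<even i rewrite Fin.toℕ-combine i (zero {1}) | Fin.toℕ-combine i (suc (zero {0})) =
  ℕ.+-monoʳ-< (2 ℕ.* Fin.toℕ i) ℕ.z<s

-- Positions are ordered lexicographically by block and offset, so two positions lie either in one
-- block of two or in different blocks.
combine-preserves : ∀ {n} (t : Vector ℝ (n ℕ.* 2)) →
  (∀ i → t (odd i) ≤ t (even i)) →
  (∀ {i j p q} → i Fin.< j → t (combine i p) ≤ t (combine j q)) →
  t Preserves Fin._≤_ ⟶ _≤_
combine-preserves {n} t within across {k} {l} k≤l
  with i , p , refl ← Fin.combine-surjective {n} {2} k
     | j , q , refl ← Fin.combine-surjective {n} {2} l
  with Fin.<-cmp i j
... | tri< i<j _ _ = across i<j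
... | tri> _ _ j<i = contradiction (Fin.combine-monoˡ-< q p j<i) (ℕ.≤⇒≯ k≤l)
... | tri≈ _ refl _ with p | q
...   | zero     | zero     = ≤-refl {t (odd i)}
...   | zero     | suc zero = within i
...   | suc zero | suc zero = ≤-refl {t (even i)}
...   | suc zero | zero     = contradiction k≤l (ℕ.<⇒≱ (odd<even i))

module _ {n} (x : Vector ℝ n) (g : ℝ) where

  pairs-odd : ∀ i → pairs x g (odd i) ≡ x i
  pairs-odd i rewrite Fin.remQuot-combine i (zero {1}) = refl

  pairs-even : ∀ i → pairs x g (even i) ≡ x i + g
  pairs-even i rewrite Fin.remQuot-combine i (suc (zero {0})) = refl

  pairs-odd≤even : 0ℝ < g → ∀ i → pairs x g (odd i) ≤ pairs x g (even i)
  pairs-odd≤even g>0 i =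
    subst₂ _≤_ (sym (pairs-odd i)) (sym (pairs-even i)) (x≤x+g {g} (x i) g>0)

  spread-pairs : ∀ m → seq (spread n (pairs x g)) m ≡ seq (n · g) m
  spread-pairs m rewrite sum-cong-≗ pairs-odd | sum-cong-≗ pairs-even | sum-+-const x g m =
    solve 2 (λ s t → (s :+ t) :- s := t) refl (seq (sum x) m) (seq (n · g) m)

pairs-mono : ∀ {n} (x : Vector ℝ (suc n)) g → x Preserves Fin._≤_ ⟶ _≤_ → 0ℝ < g →
  (∀ j → g ≤ x (suc j) - x (inject₁ j)) → pairs x g Preserves Fin._≤_ ⟶ _≤_
pairs-mono {n} x g x-mono g>0 gap = combine-preserves {suc n} (pairs x g) (pairs-odd≤even x g g>0) across
  where
  even≤odd : ∀ {i j} → i Fin.< j → x i + g ≤ x j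
  even≤odd {i} {suc j} i<1+j =
    -- As `i ≤ j`, the bounds `x i ≤ x (inject₁ j)` and `g ≤ x (suc j) - x (inject₁ j)` add up, and
    -- the right side telescopes to `x (suc j)`.
    ≤-shift {x i + g} {x (inject₁ j) + (x (suc j) - x (inject₁ j))} (x i + g) (x (suc j))
      (+-mono-≤ {x i} {x (inject₁ j)} {g} {x (suc j) - x (inject₁ j)}
        (x-mono (subst (Fin.toℕ i ℕ.≤_) (sym (Fin.toℕ-inject₁ j)) (ℕ.s≤s⁻¹ i<1+j))) (gap j))
      (λ m → cong (seq (x i) m ℚ.+ seq g m ℚ.+_)
        (solve 2 (λ p q → p :+ (q :- p) := q) refl (seq (x (inject₁ j)) m) (seq (x (suc j)) m)))

  across : ∀ {i j p q} → i Fin.< j → pairs x g (combine i p) ≤ pairs x g (combine j q)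
  across {i} {j} {p} {q} i<j =
    ≤-trans {pairs x g (combine i p)} {x i + g} {pairs x g (combine j q)} (below p)
      (≤-trans {x i + g} {x j} {pairs x g (combine j q)} (even≤odd i<j) (above q))
    where
    below : ∀ p → pairs x g (combine i p) ≤ x i + g
    below zero       = subst (_≤ x i + g) (sym (pairs-odd x g i)) (x≤x+g {g} (x i) g>0)
    below (suc zero) = subst (_≤ x i + g) (sym (pairs-even x g i)) (≤-refl {x i + g})
    above : ∀ q → x j ≤ pairs x g (combine j q)
    above zero       = subst (x j ≤_) (sym (pairs-odd x g j)) (≤-refl {x j})
    above (suc zero) = subst (x j ≤_) (sym (pairs-even x g j)) (x≤x+g {g} (x j) g>0)

-- Transpositions and the exchange of two entries

transpose-fst : ∀ {n} (p q : Fin n) → transpose p q ⟨$⟩ʳ p ≡ q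
transpose-fst p q rewrite dec-true (p Fin.≟ p) refl = refl

transpose-snd : ∀ {n} (p q : Fin n) → q ≢ p → transpose p q ⟨$⟩ʳ q ≡ p
transpose-snd p q q≢p rewrite dec-false (q Fin.≟ p) q≢p | dec-true (q Fin.≟ q) refl = refl

transpose-other : ∀ {n} (p q k : Fin n) → k ≢ p → k ≢ q → transpose p q ⟨$⟩ʳ k ≡ k
transpose-other p q k k≢p k≢q rewrite dec-false (k Fin.≟ p) k≢p | dec-false (k Fin.≟ q) k≢q = refl

odd≢even : ∀ {n} (i j : Fin n) → odd i ≢ even j
odd≢even i j eq with () ← Fin.combine-injectiveʳ i (zero {1}) j (suc zero) eq

-- Exchanging x_j + g and x_{j+1} turns the pairs (x_j , x_j + g), (x_{j+1} , x_{j+1} + g)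
-- into (x_j , x_{j+1}), (x_j + g , x_{j+1} + g).
module Exchange {n} (x : Vector ℝ (suc n)) (g : ℝ)
  (x-mono : x Preserves Fin._≤_ ⟶ _≤_) (g>0 : 0ℝ < g) (j : Fin n) where

  j₀ j₁ : Fin (suc n)
  j₀ = inject₁ j
  j₁ = suc j

  τ : Permutation′ (suc n ℕ.* 2)
  τ = transpose (even j₀) (odd j₁)

  t : Vector ℝ (suc n ℕ.* 2)
  t k = pairs x g (τ ⟨$⟩ʳ k)

  t-even-j₀ : t (even j₀) ≡ x j₁
  t-even-j₀ = trans (cong (pairs x g) (transpose-fst (even j₀) (odd j₁))) (pairs-odd x g j₁)

  t-odd-j₁ : t (odd j₁) ≡ x j₀ + g
  t-odd-j₁ = trans (cong (pairs x g) (transpose-snd (even j₀) (odd j₁) (odd≢even j₁ j₀))) (pairs-even x g j₀)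

  t-even : ∀ i → i ≢ j₀ → t (even i) ≡ x i + g
  t-even i i≢j₀ = trans
    (cong (pairs x g) (transpose-other (even j₀) (odd j₁) (even i)
      (i≢j₀ ∘ Fin.combine-injectiveˡ i (suc zero) j₀ (suc zero)) (odd≢even j₁ i ∘ sym)))
    (pairs-even x g i)

  t-odd : ∀ i → i ≢ j₁ → t (odd i) ≡ x i
  t-odd i i≢j₁ = trans
    (cong (pairs x g) (transpose-other (even j₀) (odd j₁) (odd i)
      (odd≢even i j₀) (i≢j₁ ∘ Fin.combine-injectiveˡ i zero j₁ zero)))
    (pairs-odd x g i)

  j₀<j₁ : j₀ Fin.< j₁
  j₀<j₁ = ℕ.s≤s (ℕ.≤-reflexive (Fin.toℕ-inject₁ j))

  xj₀≤xj₁ : x j₀ ≤ x j₁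
  xj₀≤xj₁ = x-mono (ℕ.<⇒≤ j₀<j₁)

  t-odd≤even : ∀ i → t (odd i) ≤ t (even i)
  t-odd≤even i with i Fin.≟ j₀ | i Fin.≟ j₁
  ... | yes refl | _ =
    subst₂ _≤_ (sym (t-odd j₀ (Fin.<⇒≢ j₀<j₁))) (sym t-even-j₀) xj₀≤xj₁
  ... | no i≢j₀ | yes refl =
    subst₂ _≤_ (sym t-odd-j₁) (sym (t-even j₁ i≢j₀))
      (+-mono-≤ {x j₀} {x j₁} {g} {g} xj₀≤xj₁ (≤-refl {g}))
  ... | no i≢j₀ | no i≢j₁ =
    subst₂ _≤_ (sym (t-odd i i≢j₁)) (sym (t-even i i≢j₀)) (x≤x+g {g} (x i) g>0)

  -- Two pairs at distance `g` become two at distance `x j₁ - x j₀`. The equation has the form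
  -- `≤-shift` takes to pass from `n · g ≤ spread t` to a comparison of `g + g` with twice the gap.
  spread-t : ∀ m → (seq g m ℚ.+ seq g m) ℚ.+ seq (spread (suc n) t) m ≡
    seq (suc n · g) m ℚ.+ seq ((x j₁ - x j₀) + (x j₁ - x j₀)) m
  spread-t m = begin
    (γ ℚ.+ γ) ℚ.+ (e ℚ.- o)
      -- The terms `p + γ` and `q` are added and cancelled so that `sum-change-at` applies to both
      -- sums.
      ≡⟨ solve 5 (λ γ e o p q → (γ :+ γ) :+ (e :- o) :=
           ((e :+ (p :+ γ)) :- (o :+ q)) :+ (γ :+ (q :- p))) refl γ e o p q ⟩
    ((e ℚ.+ (p ℚ.+ γ)) ℚ.- (o ℚ.+ q)) ℚ.+ (γ ℚ.+ (q ℚ.- p))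
      ≡⟨ cong₂ (λ u v → (u ℚ.- v) ℚ.+ (γ ℚ.+ (q ℚ.- p))) even-change odd-change ⟩
    (((X ℚ.+ M) ℚ.+ q) ℚ.- (X ℚ.+ (p ℚ.+ γ))) ℚ.+ (γ ℚ.+ (q ℚ.- p))
      ≡⟨ solve 5 (λ γ X M p q → (((X :+ M) :+ q) :- (X :+ (p :+ γ))) :+ (γ :+ (q :- p)) :=
           M :+ ((q :- p) :+ (q :- p))) refl γ X M p q ⟩
    M ℚ.+ ((q ℚ.- p) ℚ.+ (q ℚ.- p))
      ∎
    where
    open ≡-Reasoning
    γ = seq g m
    e = seq (sum (λ (i : Fin (suc n)) → t (even i))) m
    o = seq (sum (λ (i : Fin (suc n)) → t (odd i))) m
    p = seq (x j₀) m
    q = seq (x j₁) m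
    X = seq (sum x) m
    M = seq (suc n · g) m

    even-change : e ℚ.+ (p ℚ.+ γ) ≡ (X ℚ.+ M) ℚ.+ q
    even-change = trans (sum-change-at (λ i → t (even i)) (λ i → x i + g) j₀ t-even m)
      (cong₂ ℚ._+_ (sum-+-const x g m) (cong (λ y → seq y m) t-even-j₀))

    odd-change : o ℚ.+ q ≡ X ℚ.+ (p ℚ.+ γ)
    odd-change = trans (sum-change-at (λ i → t (odd i)) x j₁ t-odd m)
      (cong (λ y → X ℚ.+ seq y m) t-odd-j₁)

-- The bound on `R - U` and its equality case

lemma1 : (n : ℕ) (2≤n : 2 ℕ.≤ n) (x : Vector ℝ n) (g : ℝ) →
    x Preserves Fin._≤_ ⟶ _≤_ →
    0ℝ < g →
    (π : Permutation′ (n ℕ.* 2)) →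
    let a : Vector ℝ (n ℕ.* 2)
        a = pairs x g
        b : Vector ℝ (n ℕ.* 2)
        b = λ k → a (π ⟨$⟩ʳ k)
        R = sum (λ (i : Fin n) → b (even i))
        U = sum (λ (i : Fin n) → b (odd i))
        G = minGap 2≤n x
    in
    b Preserves Fin._≤_ ⟶ _≤_ →
    (R - U ≤ n · g) × ((R - U ≈ n · g) ⇔ (g ≤ G))
lemma1 n@(suc (suc n₀)) 2≤n@(ℕ.s≤s (ℕ.s≤s _)) x g x-mono g>0 π b-mono =
  upper , mk⇔ equality⇒gap gap⇒equality
  where
  a b : Vector ℝ (n ℕ.* 2)
  a = pairs x g
  b k = a (π ⟨$⟩ʳ k)

  gaps : Vector ℝ (suc n₀)
  gaps j = x (suc j) - x (inject₁ j)

  upper : spread n b ≤ n · g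
  upper = ≤-trans {spread n b} {spread n a} {n · g}
    -- Since `b` is `a` after `π`, the vector `a` is `b` after the inverse of `π`.
    (sorted-minimises-spread n b a (flip π) b-mono (λ k → cong a (inverseʳ π)) (pairs-odd≤even x g g>0))
    (pointwise-≤ {spread n a} {n · g} λ m → ℚ.≤-reflexive (spread-pairs x g m))

  equality⇒gap : spread n b ≈ n · g → g ≤ minimum gaps
  equality⇒gap eq = minimum-glb {x = g} gaps λ j →
    let open Exchange x g x-mono g>0 j in
    double-cancel-≤ g (gaps j)
      (≤-shift {n · g} {spread n t} (g + g) (gaps j + gaps j)
        (≤-trans {n · g} {spread n b} {spread n t} (≈⇒≥ {spread n b} {n · g} eq)
          -- The exchanged vector is `a` after `τ`, hence `b` after `τ` followed by the inverse of
          -- `π`.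
          (sorted-minimises-spread n b t (τ ∘ₚ flip π) b-mono (λ k → cong a (inverseʳ π)) t-odd≤even))
        spread-t)

  gap⇒equality : g ≤ minimum gaps → spread n b ≈ n · g
  gap⇒equality g≤G = ≤-antisym {spread n b} {n · g} upper
    (≤-trans {n · g} {spread n a} {spread n b}
      (pointwise-≤ {n · g} {spread n a} λ m → ℚ.≤-reflexive (sym (spread-pairs x g m)))
      -- The roles are reversed: `a` is now the sorted vector and `b` the competitor, whose pairs
      -- are in order because `b` is sorted.
      (sorted-minimises-spread n a b π
        (pairs-mono x g x-mono g>0 λ j → ≤-trans {g} {minimum gaps} {gaps j} g≤G (minimum-≤ gaps j))
        (λ _ → refl)
        (λ i → b-mono (ℕ.<⇒≤ (odd<even i)))))
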